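{- For a finite simple chordal outerplanar graph $G$ with maximum degree $\Delta = 4$, we have $\omega(G^2) = \chi(G^2) = \mathrm{ind}(G^2) + 1 = 6$ if $F_4$ is a subgraph of $G$, and $\omega(G^2) = \chi(G^2) = \mathrm{ind}(G^2) + 1 = 5$ otherwise.
   Context: $G^2$ is the graph on $V(G)$ in which two distinct vertices are adjacent iff their distance in $G$ is 1 or 2; $\omega$ is the clique number, $\chi$ the chromatic number, and $\mathrm{ind}(H) = \max\{\delta(H') : H' \text{ an induced subgraph of } H\}$ the inductiveness. $F_4$ is the 6-vertex graph obtained from a triangle $K_3$ by adding, for each of its three edges, a new vertex adjacent to both endpoints of that edge. -}

module Defs where

open import Data.Nat as ℕ using (ℕ; zero; suc; _≤_)
open import Data.Bool using (Bool; true; false; _∧_; _∨_; not)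
open import Data.Fin using (Fin; toℕ; _≟_) renaming (_<_ to _<ᶠ_)
open import Data.Fin.Subset using (Subset; _∈_; _∩_; ∣_∣; Nonempty)
open import Data.Vec using (tabulate)
open import Data.Product using (Σ; _×_; ∃; _,_)
open import Data.Sum using (_⊎_)
open import Relation.Nullary using (¬_; does)
open import Relation.Binary.PropositionalEquality using (_≡_; _≢_)
open import Function.Definitions using (Injective)

record SimpleGraph (n : ℕ) : Set where
  field
    adj   : Fin n → Fin n → Bool
    sym   : ∀ u v → adj u v ≡ adj v u
    irrefl : ∀ v → adj v v ≡ false
open SimpleGraph public

Adj : ℕ → Set
Adj n = Fin n → Fin n → Bool

Edge : ∀ {n} → Adj n → Fin n → Fin n → Set
Edge a u v = a u v ≡ true

anyFin : ∀ {n} → (Fin n → Bool) → Bool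
anyFin {zero} f = false
anyFin {suc n} f = f Fin.zero ∨ anyFin (λ i → f (Fin.suc i))

_² : ∀ {n} → SimpleGraph n → Adj n
(G ²) u v = not (does (u ≟ v)) ∧ (adj G u v ∨ anyFin (λ w → adj G u w ∧ adj G w v))

degIn : ∀ {n} → Adj n → Subset n → Fin n → ℕ
degIn a S v = ∣ S ∩ tabulate (a v) ∣

degree : ∀ {n} → SimpleGraph n → Fin n → ℕ
degree G v = ∣ tabulate (adj G v) ∣

MaxDegree : ∀ {n} → SimpleGraph n → ℕ → Set
MaxDegree G d = (∀ v → degree G v ≤ d) × ∃ λ v → degree G v ≡ d

HasClique : ∀ {n} → Adj n → ℕ → Set
HasClique {n} a k = Σ (Fin k → Fin n) λ f →
  Injective _≡_ _≡_ f × (∀ i j → i ≢ j → Edge a (f i) (f j))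

CliqueNumber : ∀ {n} → Adj n → ℕ → Set
CliqueNumber a k = HasClique a k × (∀ j → k ℕ.< j → ¬ HasClique a j)

Colorable : ∀ {n} → Adj n → ℕ → Set
Colorable {n} a k = Σ (Fin n → Fin k) λ c → ∀ u v → Edge a u v → c u ≢ c v

ChromaticNumber : ∀ {n} → Adj n → ℕ → Set
ChromaticNumber a k = Colorable a k × (∀ j → j ℕ.< k → ¬ Colorable a j)

-- Inductiveness: ind(H) = max over nonempty induced subgraphs H' of δ(H').
MinDegGe : ∀ {n} → Adj n → Subset n → ℕ → Set
MinDegGe a S k = ∀ v → v ∈ S → k ≤ degIn a S v

Inductiveness : ∀ {n} → Adj n → ℕ → Set
Inductiveness a k =
  (Σ _ λ S → Nonempty S × MinDegGe a S k) ×
  (∀ S → Nonempty S → ∃ λ v → v ∈ S × degIn a S v ≤ k)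

Consec : ∀ {k} → Fin k → Fin k → Set
Consec {k} i j = toℕ j ≡ suc (toℕ i) ⊎ (toℕ i ≡ 0 × suc (toℕ j) ≡ k)

CycAdj : ∀ {k} → Fin k → Fin k → Set
CycAdj i j = Consec i j ⊎ Consec j i

IsCycle : ∀ {n} → SimpleGraph n → (k : ℕ) → (Fin k → Fin n) → Set
IsCycle G k f = Injective _≡_ _≡_ f × (∀ i j → CycAdj i j → Edge (adj G) (f i) (f j))

HasChord : ∀ {n} → SimpleGraph n → (k : ℕ) → (Fin k → Fin n) → Set
HasChord G k f = Σ _ λ i → Σ _ λ j → i ≢ j × ¬ CycAdj i j × Edge (adj G) (f i) (f j)

Chordal : ∀ {n} → SimpleGraph n → Set
Chordal G = ∀ k f → 4 ≤ k → IsCycle G k f → HasChord G k f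

-- Outerplanar: vertices can be placed in (circular) order σ so that no two
-- edges cross (one-page book embedding = outerplane drawing with straight chords).
Outerplanar : ∀ {n} → SimpleGraph n → Set
Outerplanar {n} G = Σ (Fin n → Fin n) λ σ → Injective _≡_ _≡_ σ ×
  (∀ a b c d → Edge (adj G) a b → Edge (adj G) c d →
     ¬ (σ a <ᶠ σ c × σ c <ᶠ σ b × σ b <ᶠ σ d))

edgeF4 : ℕ → ℕ → Bool
edgeF4 0 1 = true
edgeF4 1 2 = true
edgeF4 0 2 = true
edgeF4 0 3 = true
edgeF4 1 3 = true
edgeF4 1 4 = true
edgeF4 2 4 = true
edgeF4 0 5 = true
edgeF4 2 5 = true
edgeF4 _ _ = false

adjF4 : Adj 6
adjF4 i j = edgeF4 (toℕ i) (toℕ j) ∨ edgeF4 (toℕ j) (toℕ i)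

SubgraphOf : ∀ {m n} → Adj m → SimpleGraph n → Set
SubgraphOf {m} {n} h G = Σ (Fin m → Fin n) λ f → Injective _≡_ _≡_ f ×
  (∀ u v → Edge h u v → Edge (adj G) (f u) (f v))

{-# OPTIONS --safe #-}
module Submission where

-- A nonempty induced subgraph G[U] of G has a simplicial vertex v with at most 4
-- vertices within distance 2, or at most 5 if G contains F₄. Simplicial deletions
-- commute with squaring, so G² is 4-degenerate (resp. 5-degenerate); this bounds
-- ind(G²), χ(G²) and ω(G²) from above. The closed neighbourhood of a vertex of
-- degree 4, or a copy of F₄, is a clique of G² meeting the bound.
--
-- To find v, lay the vertices out on a line so that edges do not cross. By induction
-- on the length of an edge ab, either the required vertex exists, or what lies below
-- ab is nothing, a single vertex adjacent to a and b, or a triangle abx with one such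
-- vertex on each of ax and xb. If ab has no common neighbour below it, chordality
-- makes the interval below ab fall apart into pieces hanging from a or b alone, and
-- such a piece always contains the required vertex.

open import Defs
open import Data.Nat using (ℕ; zero; suc; _+_; _≤_; _<_; _<?_; z≤n; s≤s; ∣_-_∣)
open import Data.Nat.Properties using (≤-refl; ≤-trans; ≤-reflexive; ≤-total; ≤-pred; <-trans; <-irrefl; <-cmp; <⇒≤; <⇒≱; <-≤-trans; ≤-<-trans; n<1+n; n≤1+n; ≤∧≢⇒<; suc-injective; ∸-monoˡ-<; ∸-monoʳ-<; m≤n⇒∣m-n∣≡n∸m; ∣-∣-comm)
open import Data.Bool using (Bool; true; false; _∧_)
open import Data.Bool.Properties using (∨-zeroʳ) renaming (_≟_ to _≟ᵇ_)
open import Data.Fin using (Fin; zero; suc; toℕ; punchIn; _≟_; #_)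
open import Data.Fin.Properties using (any?; all?; toℕ-injective; injective⇒≤; punchIn-injective; punchInᵢ≢i) renaming (suc-injective to sucᶠ-injective)
open import Data.Fin.Subset using (Subset; _∈_; ∣_∣; Nonempty; _⊆_; ⊤; inside; outside) renaming (_-_ to _∖_)
open import Data.Fin.Subset.Properties using (_∈?_; ∣p∣≤n; ∈⊤; x∈p∩q⁺; x∈p∩q⁻; x∈p∧x≢y⇒x∈p-y; x∈p⇒∣p-x∣<∣p∣; p─q⊆p)
open import Data.List using (List; []; _∷_; length; map; filter)
open import Data.List.Properties using (length-map; filter-notAll)
open import Data.List.Membership.Propositional using () renaming (_∈_ to _∈ₗ_)
open import Data.List.Membership.Propositional.Properties using (∈-map⁺; ∈-filter⁺)
open import Data.List.Membership.Setoid.Properties using (index-injective)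
open import Data.List.Relation.Unary.Any as Any using (here; there)
open import Data.List.Relation.Unary.All as All using (All; []; _∷_)
open import Data.Product using (Σ-syntax; ∃; _×_; _,_; proj₁; proj₂)
open import Data.Product.Properties using (≡-dec)
open import Data.Sum using (_⊎_; inj₁; inj₂; swap)
open import Data.Vec as Vec using (Vec; []; _∷_; lookup; here; there)
open import Data.Vec.Properties using (lookup∘tabulate; lookup⇒[]=; []=⇒lookup)
open import Data.Vec.Relation.Unary.All using ([]; _∷_)
open import Data.Vec.Relation.Unary.AllPairs using ([]; _∷_)
open import Data.Vec.Relation.Unary.Unique.Propositional using (Unique)
open import Data.Vec.Relation.Unary.Unique.Propositional.Properties using (lookup-injective)
open import Function using (_∘_)
open import Function.Definitions using (Injective)
open import Relation.Binary.Definitions using (tri<; tri≈; tri>)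
open import Relation.Binary.PropositionalEquality using (_≡_; _≢_; refl; trans; cong; subst; subst₂; ≢-sym; setoid) renaming (sym to ≡-sym)
open import Relation.Nullary using (¬_; Dec; yes; no; does; ¬?; contradiction)
open import Relation.Nullary.Decidable using (_×-dec_; _⊎-dec_; _→-dec_; from-yes; dec-true)
open import Relation.Unary using (Decidable)

import Data.List.Membership.DecPropositional as DecMembership

-- Counting with subsets and lists

does≡true⇒ : ∀ {A : Set} (A? : Dec A) → does A? ≡ true → A
does≡true⇒ (yes a) _ = a

∈-tabulate⁺ : ∀ {n} (f : Fin n → Bool) {x} → f x ≡ true → x ∈ Vec.tabulate f
∈-tabulate⁺ f {x} fx = lookup⇒[]= x _ (trans (lookup∘tabulate f x) fx)

∈-tabulate⁻ : ∀ {n} (f : Fin n → Bool) {x} → x ∈ Vec.tabulate f → f x ≡ true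
∈-tabulate⁻ f {x} x∈ = trans (≡-sym (lookup∘tabulate f x)) ([]=⇒lookup x∈)

enumerate : ∀ {n} (p : Subset n) →
  Σ[ g ∈ (Fin ∣ p ∣ → Fin n) ] Injective _≡_ _≡_ g × (∀ i → g i ∈ p)
enumerate [] = (λ ()) , (λ {}) , λ ()
enumerate (outside ∷ p) with enumerate p
... | g , inj , mem = suc ∘ g , inj ∘ sucᶠ-injective , there ∘ mem
enumerate {suc n} (inside ∷ p) with enumerate p
... | g , inj , mem = g′ , inj′ , mem′
  where
  g′ : Fin (suc ∣ p ∣) → Fin (suc n)
  g′ zero    = zero
  g′ (suc i) = suc (g i)
  inj′ : Injective _≡_ _≡_ g′
  inj′ {zero}  {zero}  _  = refl
  inj′ {suc i} {suc j} eq = cong suc (inj (sucᶠ-injective eq))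
  mem′ : ∀ i → g′ i ∈ inside ∷ p
  mem′ zero    = here
  mem′ (suc i) = there (mem i)

members : ∀ {n} (p : Subset n) → Σ[ L ∈ List (Fin n) ] length L ≡ ∣ p ∣ × (∀ {x} → x ∈ p → x ∈ₗ L)
members [] = [] , refl , λ ()
members (outside ∷ p) with members p
... | L , len , mem = map suc L , trans (length-map suc L) len , λ { (there x∈p) → ∈-map⁺ suc (mem x∈p) }
members (inside ∷ p) with members p
... | L , len , mem = zero ∷ map suc L , cong suc (trans (length-map suc L) len) ,
  λ { here → here refl ; (there x∈p) → there (∈-map⁺ suc (mem x∈p)) }

-- A position in `L` determines the element found there, so sending each element of `p` to its
-- position in `L` is injective.
∣p∣≤length : ∀ {n} (p : Subset n) (L : List (Fin n)) → (∀ {x} → x ∈ p → x ∈ₗ L) → ∣ p ∣ ≤ length L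
∣p∣≤length p L p⊆L with enumerate p
... | g , inj , mem = injective⇒≤ {f = λ i → Any.index (p⊆L (mem i))}
  λ eq → inj (index-injective (setoid _) (p⊆L (mem _)) (p⊆L (mem _)) eq)

injection⇒≤∣p∣ : ∀ {n k} (p : Subset n) (g : Fin k → Fin n) → Injective _≡_ _≡_ g → (∀ i → g i ∈ p) → k ≤ ∣ p ∣
injection⇒≤∣p∣ {k = zero}  p g inj mem = z≤n
injection⇒≤∣p∣ {k = suc k} p g inj mem = ≤-<-trans
  (injection⇒≤∣p∣ (p ∖ g zero) (g ∘ suc) (sucᶠ-injective ∘ inj)
    (λ i → x∈p∧x≢y⇒x∈p-y (mem (suc i)) λ eq → contradiction (inj eq) λ ()))
  (x∈p⇒∣p-x∣<∣p∣ (mem zero))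

-- The source of every extremal choice below: farthest neighbours, vertices nearest to an end, the
-- last vertex. There `f` is a distance or a position.
argmax : ∀ {n} {P : Fin n → Set} → Decidable P → (f : Fin n → ℕ) →
  (∀ x → ¬ P x) ⊎ Σ[ x ∈ Fin n ] P x × (∀ y → P y → f y ≤ f x)
argmax {zero}  P? f = inj₁ λ ()
argmax {suc n} {P} P? f with P? zero | argmax (P? ∘ suc) (f ∘ suc)
... | no ¬p | inj₁ none = inj₁ λ { zero → ¬p ; (suc x) → none x }
... | no ¬p | inj₂ (x , px , max) = inj₂ (suc x , px , λ { zero p → contradiction p ¬p ; (suc y) → max y })
... | yes p | inj₁ none = inj₂ (zero , p , λ { zero _ → ≤-refl ; (suc y) py → contradiction py (none y) })
... | yes p | inj₂ (x , px , max) with ≤-total (f zero) (f (suc x))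
...   | inj₁ le = inj₂ (suc x , px , λ { zero _ → le ; (suc y) → max y })
...   | inj₂ ge = inj₂ (zero , p , λ { zero _ → ≤-refl ; (suc y) py → ≤-trans (max y py) ge })

-- Bounds the number of solutions of `P` without deciding `P`: the list may contain repetitions and
-- elements outside `P`.
Cover : ∀ {n} → (Fin n → Set) → ℕ → Set
Cover {n} P k = Σ[ L ∈ List (Fin n) ] length L ≤ k × (∀ w → P w → w ∈ₗ L)

-- Each known solution uses up one place of the bound. Applied to the four places for neighbours,
-- three known neighbours leave room for only one unknown.
Cover-remove : ∀ {n k} {P : Fin n → Set} → Cover P (suc k) → ∀ v → P v → Cover (λ w → P w × w ≢ v) k
Cover-remove (L , len , mem) v pv =
  filter (λ w → ¬? (w ≟ v)) L ,
  ≤-pred (<-≤-trans (filter-notAll (λ w → ¬? (w ≟ v)) L (Any.map (λ eq ne → ne (≡-sym eq)) (mem v pv))) len) ,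
  λ w (pw , w≢v) → ∈-filter⁺ (λ w → ¬? (w ≟ v)) (mem w pw) w≢v

-- Degenerate graphs

Degenerate : ∀ {n} → Adj n → ℕ → Set
Degenerate {n} a k = ∀ S → Nonempty S → Σ[ v ∈ Fin n ] v ∈ S × Cover (λ w → w ∈ S × Edge a v w) k

degenerate⇒degIn≤ : ∀ {n} {a : Adj n} {k} → Degenerate a k → ∀ S → Nonempty S → ∃ λ v → v ∈ S × degIn a S v ≤ k
degenerate⇒degIn≤ {a = a} deg S ne with deg S ne
... | v , v∈S , L , len , mem = v , v∈S , ≤-trans
  (∣p∣≤length _ L λ x∈ → let (x∈S , x∈N) = x∈p∩q⁻ S _ x∈ in mem _ (x∈S , ∈-tabulate⁻ (a v) x∈N)) len

-- Pigeonhole: if all colours occurred in `L`, their positions would inject `suc k` colours into at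
-- most `k` places.
∃-free : ∀ {k} (L : List (Fin (suc k))) → length L ≤ k → Σ[ i ∈ Fin (suc k) ] ¬ i ∈ₗ L
∃-free L len with any? (λ i → ¬? (DecMembership._∈?_ _≟_ i L))
... | yes free = free
... | no ¬free = contradiction (injective⇒≤ {f = λ i → Any.index (all i)} (λ eq → index-injective (setoid _) (all _) (all _) eq)) (<⇒≱ (s≤s len))
  where
  all : ∀ i → i ∈ₗ L
  all i with DecMembership._∈?_ _≟_ i L
  ... | yes i∈ = i∈
  ... | no i∉ = contradiction (i , i∉) ¬free

-- Greedy colouring: set aside a vertex of `S` with at most `k` neighbours in `S`, colour the rest,
-- then give it a colour missing from those neighbours. Here `m` bounds the size of `S`, and colours
-- outside `S` are arbitrary.
degenerate⇒colorable : ∀ {n} {a : Adj n} {k} → (∀ u v → Edge a u v → Edge a v u) → (∀ v → ¬ Edge a v v) →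
  Degenerate a k → Colorable a (suc k)
degenerate⇒colorable {n} {a} {k} a-sym a-irrefl deg =
  let (c , proper) = colour (suc n) ⊤ (s≤s (∣p∣≤n ⊤)) in c , λ u v → proper u v ∈⊤ ∈⊤
  where
  colour : ∀ m (S : Subset n) → ∣ S ∣ < m →
    Σ[ c ∈ (Fin n → Fin (suc k)) ] (∀ u v → u ∈ S → v ∈ S → Edge a u v → c u ≢ c v)
  colour (suc m) S size with any? (_∈? S)
  ... | no empty = (λ _ → zero) , λ u _ u∈S → contradiction (u , u∈S) empty
  ... | yes ne with deg S ne
  ... | v , v∈S , L , len , mem with colour m (S ∖ v) (<-≤-trans (x∈p⇒∣p-x∣<∣p∣ v∈S) (≤-pred size))
  ... | c , proper with ∃-free (map c L) (≤-trans (≤-reflexive (length-map c L)) len)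
  ... | i , i∉ = c′ , proper′
    where
    c′ : Fin n → Fin (suc k)
    c′ u with u ≟ v
    ... | yes _ = i
    ... | no _  = c u
    proper′ : ∀ u w → u ∈ S → w ∈ S → Edge a u w → c′ u ≢ c′ w
    proper′ u w u∈S w∈S e with u ≟ v | w ≟ v
    ... | yes refl | yes refl = λ _ → a-irrefl u e
    ... | yes refl | no _ = λ eq → i∉ (subst (_∈ₗ map c L) (≡-sym eq) (∈-map⁺ c (mem w (w∈S , e))))
    ... | no _ | yes refl = λ eq → i∉ (subst (_∈ₗ map c L) eq (∈-map⁺ c (mem u (u∈S , a-sym u w e))))
    ... | no u≢v | no w≢v = proper u w (x∈p∧x≢y⇒x∈p-y u∈S u≢v) (x∈p∧x≢y⇒x∈p-y w∈S w≢v) e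

clique≤colours : ∀ {n} {a : Adj n} {j k} → HasClique a j → Colorable a k → j ≤ k
clique≤colours {j = j} {k} (f , inj , edges) (c , proper) = injective⇒≤ {f = c ∘ f} inj′
  where
  inj′ : Injective _≡_ _≡_ (c ∘ f)
  inj′ {x} {y} eq with x ≟ y
  ... | yes x≡y = x≡y
  ... | no x≢y = contradiction eq (proper _ _ (edges x y x≢y))

-- In the image of `f`, the vertex `f i` is adjacent to the `k` other values, which `punchIn i`
-- enumerates.
clique⇒MinDegGe : ∀ {n} {a : Adj n} {k} → HasClique a (suc k) → Σ[ S ∈ Subset n ] Nonempty S × MinDegGe a S k
clique⇒MinDegGe {n} {a} {k} (f , inj , edges) = S , (f zero , image zero) , minDeg
  where
  inImage? : ∀ v → Dec (∃ λ i → f i ≡ v)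
  inImage? v = any? λ i → f i ≟ v
  S : Subset n
  S = Vec.tabulate (does ∘ inImage?)
  image : ∀ i → f i ∈ S
  image i = ∈-tabulate⁺ (does ∘ inImage?) (dec-true (inImage? (f i)) (i , refl))
  minDeg : MinDegGe a S k
  minDeg v v∈S with does≡true⇒ (inImage? v) (∈-tabulate⁻ (does ∘ inImage?) v∈S)
  ... | i , refl = injection⇒≤∣p∣ _ (f ∘ punchIn i) (punchIn-injective i _ _ ∘ inj)
    λ j → x∈p∩q⁺ (image (punchIn i j) , ∈-tabulate⁺ (a (f i)) (edges i (punchIn i j) (≢-sym (punchInᵢ≢i i j))))

-- The clique gives all lower bounds and degeneracy all upper ones; `clique≤colours` serves both
-- against a larger clique and against fewer colours.
clique×degenerate : ∀ {n} {a : Adj n} {k} → (∀ u v → Edge a u v → Edge a v u) → (∀ v → ¬ Edge a v v) →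
  HasClique a (suc k) → Degenerate a k →
  CliqueNumber a (suc k) × ChromaticNumber a (suc k) × Inductiveness a k
clique×degenerate a-sym a-irrefl clique deg =
  (clique , λ j k<j c → <⇒≱ k<j (clique≤colours c col)) ,
  (col , λ j j<k c → <⇒≱ j<k (clique≤colours clique c)) ,
  (clique⇒MinDegGe clique , degenerate⇒degIn≤ deg)
  where col = degenerate⇒colorable a-sym a-irrefl deg

-- Linear betweenness

module Betweenness {n} (pos : Fin n → ℕ) (pos-injective : Injective _≡_ _≡_ pos) where

  -- Unoriented, so that exchanging `a` and `b` yields the mirror image of any argument.
  Btw : Fin n → Fin n → Fin n → Set
  Btw a w b = (pos a < pos w × pos w < pos b) ⊎ (pos b < pos w × pos w < pos a)

  Btw? : ∀ a w b → Dec (Btw a w b)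
  Btw? a w b = ((_ <? _) ×-dec (_ <? _)) ⊎-dec ((_ <? _) ×-dec (_ <? _))

  dist : Fin n → Fin n → ℕ
  dist a b = ∣ pos a - pos b ∣

  dist-sym : ∀ a b → dist a b ≡ dist b a
  dist-sym a b = ∣-∣-comm (pos a) (pos b)

  Btw-sym : ∀ {a w b} → Btw a w b → Btw b w a
  Btw-sym = swap

  Btw⇒≢ˡ : ∀ {a w b} → Btw a w b → a ≢ w
  Btw⇒≢ˡ (inj₁ (p , _)) refl = <-irrefl refl p
  Btw⇒≢ˡ (inj₂ (_ , q)) refl = <-irrefl refl q

  Btw⇒≢ʳ : ∀ {a w b} → Btw a w b → w ≢ b
  Btw⇒≢ʳ x eq = Btw⇒≢ˡ (Btw-sym x) (≡-sym eq)

  Btw⇒≢ : ∀ {a w b} → Btw a w b → a ≢ b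
  Btw⇒≢ (inj₁ (p , q)) refl = <-irrefl refl (<-trans p q)
  Btw⇒≢ (inj₂ (p , q)) refl = <-irrefl refl (<-trans p q)

  split : ∀ {a w b z} → Btw a w b → Btw a z b → z ≡ w ⊎ Btw a z w ⊎ Btw w z b
  split {w = w} {z = z} (inj₁ (p , q)) (inj₁ (r , s)) with <-cmp (pos z) (pos w)
  ... | tri< z<w _ _ = inj₂ (inj₁ (inj₁ (r , z<w)))
  ... | tri≈ _ z≡w _ = inj₁ (pos-injective z≡w)
  ... | tri> _ _ w<z = inj₂ (inj₂ (inj₁ (w<z , s)))
  split {w = w} {z = z} (inj₂ (p , q)) (inj₂ (r , s)) with <-cmp (pos z) (pos w)
  ... | tri< z<w _ _ = inj₂ (inj₂ (inj₂ (r , z<w)))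
  ... | tri≈ _ z≡w _ = inj₁ (pos-injective z≡w)
  ... | tri> _ _ w<z = inj₂ (inj₁ (inj₂ (w<z , s)))
  split (inj₁ (p , q)) (inj₂ (r , s)) = contradiction (<-trans (<-trans p q) (<-trans r s)) (<-irrefl refl)
  split (inj₂ (p , q)) (inj₁ (r , s)) = contradiction (<-trans (<-trans p q) (<-trans r s)) (<-irrefl refl)

  widenʳ : ∀ {a c b w} → Btw a c b → Btw a w c → Btw a w b
  widenʳ (inj₁ (p , q)) (inj₁ (r , s)) = inj₁ (r , <-trans s q)
  widenʳ (inj₂ (p , q)) (inj₂ (r , s)) = inj₂ (<-trans p r , s)
  widenʳ (inj₁ (p , q)) (inj₂ (r , s)) = contradiction (<-trans p (<-trans r s)) (<-irrefl refl)
  widenʳ (inj₂ (p , q)) (inj₁ (r , s)) = contradiction (<-trans q (<-trans r s)) (<-irrefl refl)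

  widenˡ : ∀ {a c b w} → Btw a c b → Btw c w b → Btw a w b
  widenˡ x y = Btw-sym (widenʳ (Btw-sym x) (Btw-sym y))

  narrow : ∀ {a c d b} → Btw a c b → Btw c d b → Btw a c d
  narrow (inj₁ (p , q)) (inj₁ (r , s)) = inj₁ (p , r)
  narrow (inj₂ (p , q)) (inj₂ (r , s)) = inj₂ (s , q)
  narrow (inj₁ (p , q)) (inj₂ (r , s)) = contradiction (<-trans q (<-trans r s)) (<-irrefl refl)
  narrow (inj₂ (p , q)) (inj₁ (r , s)) = contradiction (<-trans p (<-trans r s)) (<-irrefl refl)

  disjoint : ∀ {a c b z} → Btw a c b → Btw a z c → ¬ Btw c z b
  disjoint (inj₁ (p , q)) (inj₁ (r , s)) (inj₁ (t , u)) = <-irrefl refl (<-trans s t)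
  disjoint (inj₁ (p , q)) (inj₁ (r , s)) (inj₂ (t , u)) = <-irrefl refl (<-trans q (<-trans t u))
  disjoint (inj₁ (p , q)) (inj₂ (r , s)) _ = <-irrefl refl (<-trans p (<-trans r s))
  disjoint (inj₂ (p , q)) (inj₂ (r , s)) (inj₂ (t , u)) = <-irrefl refl (<-trans r u)
  disjoint (inj₂ (p , q)) (inj₂ (r , s)) (inj₁ (t , u)) = <-irrefl refl (<-trans p (<-trans t u))
  disjoint (inj₂ (p , q)) (inj₁ (r , s)) _ = <-irrefl refl (<-trans q (<-trans r s))

  -- Makes the recursions over intervals terminate.
  Btw⇒dist< : ∀ {a c b} → Btw a c b → dist a c < dist a b
  Btw⇒dist< {a} {c} {b} (inj₁ (p , q)) = subst₂ _<_
    (≡-sym (m≤n⇒∣m-n∣≡n∸m (<⇒≤ p))) (≡-sym (m≤n⇒∣m-n∣≡n∸m (<⇒≤ (<-trans p q))))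
    (∸-monoˡ-< q (<⇒≤ p))
  Btw⇒dist< {a} {c} {b} (inj₂ (p , q)) = subst₂ _<_
    (trans (≡-sym (m≤n⇒∣m-n∣≡n∸m (<⇒≤ q))) (dist-sym c a))
    (trans (≡-sym (m≤n⇒∣m-n∣≡n∸m (<⇒≤ (<-trans p q)))) (dist-sym b a))
    (∸-monoʳ-< p (<⇒≤ q))

  Btw-asym : ∀ {a c b} → Btw a c b → ¬ Btw a b c
  Btw-asym x y = <-irrefl refl (<-trans (Btw⇒dist< x) (Btw⇒dist< y))

  -- The interval from `c` (excluded) to `b` (included). The condition `c ≢ b` makes it empty when
  -- the ends coincide.
  Upto : Fin n → Fin n → Fin n → Set
  Upto c b z = Btw c z b ⊎ (z ≡ b × c ≢ b)

  Upto? : ∀ c b z → Dec (Upto c b z)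
  Upto? c b z = Btw? c z b ⊎-dec ((z ≟ b) ×-dec ¬? (c ≟ b))

  Upto⇒≢ : ∀ {c b z} → Upto c b z → c ≢ z
  Upto⇒≢ (inj₁ x) = Btw⇒≢ˡ x
  Upto⇒≢ (inj₂ (refl , ne)) = ne

  Upto⇒≢end : ∀ {c b z} → Upto c b z → c ≢ b
  Upto⇒≢end (inj₁ x) = Btw⇒≢ x
  Upto⇒≢end (inj₂ (_ , ne)) = ne

  Upto-chain : ∀ {c b c′ z} → Upto c b c′ → Upto c′ b z → Btw c c′ z
  Upto-chain (inj₁ x) (inj₁ y) = narrow x y
  Upto-chain (inj₁ x) (inj₂ (refl , _)) = x
  Upto-chain (inj₂ (refl , _)) (inj₁ y) = contradiction refl (Btw⇒≢ y)
  Upto-chain (inj₂ (refl , _)) (inj₂ (_ , ne)) = contradiction refl ne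

  Upto-trans : ∀ {c b c′ z} → Upto c b c′ → Upto c′ b z → Upto c b z
  Upto-trans (inj₁ x) (inj₁ y) = inj₁ (widenˡ x y)
  Upto-trans (inj₁ x) (inj₂ (refl , _)) = inj₂ (refl , Btw⇒≢ x)
  Upto-trans (inj₂ (refl , _)) (inj₁ y) = contradiction refl (Btw⇒≢ y)
  Upto-trans (inj₂ (refl , _)) (inj₂ (_ , ne)) = contradiction refl ne

  -- A point past `c′` is strictly farther from `c` than `c′` is.
  farthest⇒¬beyond : ∀ {c b c′} {P : Fin n → Set} → (∀ y → P y → dist c y ≤ dist c c′) → Upto c b c′ →
    ∀ z → Upto c′ b z → ¬ P z
  farthest⇒¬beyond max x z y pz = <⇒≱ (Btw⇒dist< (Upto-chain x y)) (max z pz)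

-- Copies of F₄ and the size bound

F4-edges : List (Fin 6 × Fin 6)
F4-edges = (# 0 , # 1) ∷ (# 1 , # 2) ∷ (# 0 , # 2) ∷ (# 0 , # 3) ∷ (# 1 , # 3) ∷
           (# 1 , # 4) ∷ (# 2 , # 4) ∷ (# 0 , # 5) ∷ (# 2 , # 5) ∷ []

F4-edges-complete : ∀ i j → edgeF4 (toℕ i) (toℕ j) ≡ true → (i , j) ∈ₗ F4-edges
F4-edges-complete = from-yes (all? λ (i : Fin 6) → all? λ (j : Fin 6) →
  (edgeF4 (toℕ i) (toℕ j) ≟ᵇ true) →-dec DecMembership._∈?_ (≡-dec _≟_ _≟_) (i , j) F4-edges)

-- Reduces an embedding to six distinct vertices and nine edges, each in one direction.
F4-subgraph : ∀ {n} (G : SimpleGraph n) (vs : Vec (Fin n) 6) → Unique vs →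
  All (λ (i , j) → Edge (adj G) (lookup vs i) (lookup vs j)) F4-edges → SubgraphOf adjF4 G
F4-subgraph G vs unique edges = lookup vs , lookup-injective unique _ _ , preserves
  where
  preserves : ∀ i j → Edge adjF4 i j → Edge (adj G) (lookup vs i) (lookup vs j)
  preserves i j e with edgeF4 (toℕ i) (toℕ j) in eq
  ... | true  = All.lookup edges (F4-edges-complete i j eq)
  -- The first disjunct of `adjF4 i j` fails, so `e` speaks of the reversed edge, which is in the
  -- list.
  ... | false = trans (sym G _ _) (All.lookup edges (F4-edges-complete j i e))

-- A bound of five has to come with a copy of F₄, so one search for a good vertex serves both cases
-- of the theorem.
Small : ∀ {n} → SimpleGraph n → ℕ → Set
Small G k = k ≤ 4 ⊎ (SubgraphOf adjF4 G × k ≤ 5)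

-- Simplicial vertices of G[U]

module Alive {n} (G : SimpleGraph n) (U : Subset n) where

  E : Fin n → Fin n → Set
  E u v = u ∈ U × v ∈ U × Edge (adj G) u v

  E? : ∀ u v → Dec (E u v)
  E? u v = (u ∈? U) ×-dec (v ∈? U) ×-dec (adj G u v ≟ᵇ true)

  E-sym : ∀ {u v} → E u v → E v u
  E-sym (u∈ , v∈ , e) = v∈ , u∈ , trans (sym G _ _) e

  E-irrefl : ∀ {v} → ¬ E v v
  E-irrefl {v} (_ , _ , e) with trans (≡-sym e) (irrefl G v)
  ... | ()

  E⇒≢ : ∀ {u v} → E u v → u ≢ v
  E⇒≢ e refl = E-irrefl e

  -- Adjacency in the square of G[U]: a middle vertex must itself lie in `U`, so this can be sparser
  -- than G² on `U`.
  Near : Fin n → Fin n → Set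
  Near v w = w ≢ v × (E v w ⊎ Σ[ z ∈ Fin n ] E v z × E z w)

  Simplicial : Fin n → Set
  Simplicial v = ∀ u w → E v u → E v w → u ≢ w → E u w

  Good : Fin n → Set
  Good v = v ∈ U × Simplicial v × Σ[ L ∈ List (Fin n) ] Small G (length L) × (∀ w → Near v w → w ∈ₗ L)

-- Good vertices of a graph drawn on a line

module GoodVertex {n} (G : SimpleGraph n) (U : Subset n) (chordal : Chordal G)
  (pos : Fin n → ℕ) (pos-injective : Injective _≡_ _≡_ pos)
  (noncrossing : ∀ a b c d → Edge (adj G) a b → Edge (adj G) c d → ¬ (pos a < pos c × pos c < pos b × pos b < pos d))
  (degree≤4 : ∀ v → degree G v ≤ 4) where

  open Alive G U
  open Betweenness pos pos-injective

  Found : Set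
  Found = ∃ Good

  nbrs : ∀ v → Cover (E v) 4
  nbrs v with members (Vec.tabulate (adj G v))
  ... | L , len , mem = L , ≤-trans (≤-reflexive len) (degree≤4 v) , λ w (_ , _ , e) → mem (∈-tabulate⁺ (adj G v) e)

  -- An edge from below `ab` to a point outside the closed interval would cross `ab`.
  confined : ∀ {a b w z} → E a b → Btw a w b → E w z → z ≡ a ⊎ z ≡ b ⊎ Btw a z b
  confined {a} {b} {w} {z} (_ , _ , ab) (inj₁ (a<w , w<b)) (_ , _ , wz) with <-cmp (pos z) (pos a) | <-cmp (pos z) (pos b)
  ... | tri< z<a _ _ | _ = contradiction (z<a , a<w , w<b) (noncrossing z w a b (trans (sym G z w) wz) ab)
  ... | tri≈ _ eq _ | _ = inj₁ (pos-injective eq)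
  ... | tri> _ _ a<z | tri< z<b _ _ = inj₂ (inj₂ (inj₁ (a<z , z<b)))
  ... | tri> _ _ _ | tri≈ _ eq _ = inj₂ (inj₁ (pos-injective eq))
  ... | tri> _ _ _ | tri> _ _ b<z = contradiction (a<w , w<b , b<z) (noncrossing a b w z ab wz)
  confined e (inj₂ x) e′ with confined (E-sym e) (inj₁ x) e′
  ... | inj₁ eq = inj₂ (inj₁ eq)
  ... | inj₂ (inj₁ eq) = inj₁ eq
  ... | inj₂ (inj₂ y) = inj₂ (inj₂ (Btw-sym y))

  apex-nbrs : ∀ {a b x z} → E a b → Btw a x b → E x z → z ≡ a ⊎ z ≡ b ⊎ Btw a z x ⊎ Btw x z b
  apex-nbrs ab x xz with confined ab x xz
  ... | inj₁ eq = inj₁ eq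
  ... | inj₂ (inj₁ eq) = inj₂ (inj₁ eq)
  ... | inj₂ (inj₂ z) with split x z
  ...   | inj₁ refl = contradiction xz E-irrefl
  ...   | inj₂ y = inj₂ (inj₂ y)

  -- Configurations below an edge

  Bare : Fin n → Fin n → Set
  Bare a b = ∀ w → w ∈ U → ¬ Btw a w b

  record Tip (a b v : Fin n) : Set where
    field
      between : Btw a v b
      edgeˡ   : E a v
      edgeʳ   : E v b
      bareˡ   : Bare a v
      bareʳ   : Bare v b
  open Tip

  -- The part of F₄ strictly between a and b, where abx is the middle triangle.
  record Fan (a b x v y : Fin n) : Set where
    field
      between : Btw a x b
      edgeˡ   : E a x
      edgeʳ   : E x b
      tipˡ    : Tip a x v
      tipʳ    : Tip x b y
  open Fan

  data Shape (a b : Fin n) : Set where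
    bare : Bare a b → Shape a b
    tip  : ∀ v → Tip a b v → Shape a b
    fan  : ∀ x v y → Fan a b x v y → Shape a b

  Bare-sym : ∀ {a b} → Bare a b → Bare b a
  Bare-sym e w w∈ x = e w w∈ (Btw-sym x)

  Tip-sym : ∀ {a b v} → Tip a b v → Tip b a v
  Tip-sym t = record { between = Btw-sym (between t) ; edgeˡ = E-sym (edgeʳ t) ; edgeʳ = E-sym (edgeˡ t)
                     ; bareˡ = Bare-sym (bareʳ t) ; bareʳ = Bare-sym (bareˡ t) }

  Fan-sym : ∀ {a b x v y} → Fan a b x v y → Fan b a x y v
  Fan-sym t = record { between = Btw-sym (between t) ; edgeˡ = E-sym (edgeʳ t) ; edgeʳ = E-sym (edgeˡ t)
                     ; tipˡ = Tip-sym (tipʳ t) ; tipʳ = Tip-sym (tipˡ t) }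

  -- Good vertices in small configurations

  tip-unique : ∀ {a b v w} → Tip a b v → w ∈ U → Btw a w b → w ≡ v
  tip-unique t w∈ w with split (between t) w
  ... | inj₁ eq = eq
  ... | inj₂ (inj₁ y) = contradiction y (bareˡ t _ w∈)
  ... | inj₂ (inj₂ y) = contradiction y (bareʳ t _ w∈)

  tip-nbrs : ∀ {a b v z} → E a b → Tip a b v → E v z → z ≡ a ⊎ z ≡ b
  tip-nbrs ab t vz with apex-nbrs ab (between t) vz
  ... | inj₁ eq = inj₁ eq
  ... | inj₂ (inj₁ eq) = inj₂ eq
  ... | inj₂ (inj₂ (inj₁ y)) = contradiction y (bareˡ t _ (proj₁ (proj₂ vz)))
  ... | inj₂ (inj₂ (inj₂ y)) = contradiction y (bareʳ t _ (proj₁ (proj₂ vz)))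

  -- The only neighbours of the tip are `a` and `b`. They are adjacent, so the tip is simplicial,
  -- and all that is near it is a neighbour of `a` or of `b`.
  tip-good : ∀ {a b v} → E a b → Tip a b v → (L : List (Fin n)) → Small G (length L) →
    (∀ w → w ≢ v → E a w → w ∈ₗ L) → (∀ w → w ≢ v → E b w → w ∈ₗ L) → Found
  tip-good {a} {b} {v} ab t L small coverᵃ coverᵇ = v , proj₁ (edgeʳ t) , simplicial , L , small , near
    where
    simplicial : Simplicial v
    simplicial u w vu vw u≢w with tip-nbrs ab t vu | tip-nbrs ab t vw
    ... | inj₁ refl | inj₁ refl = contradiction refl u≢w
    ... | inj₁ refl | inj₂ refl = ab
    ... | inj₂ refl | inj₁ refl = E-sym ab
    ... | inj₂ refl | inj₂ refl = contradiction refl u≢w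
    near : ∀ w → Near v w → w ∈ₗ L
    near w (w≢v , inj₁ vw) with tip-nbrs ab t vw
    ... | inj₁ refl = coverᵇ w w≢v (E-sym ab)
    ... | inj₂ refl = coverᵃ w w≢v ab
    near w (w≢v , inj₂ (z , vz , zw)) with tip-nbrs ab t vz
    ... | inj₁ refl = coverᵃ w w≢v zw
    ... | inj₂ refl = coverᵇ w w≢v zw

  isolated-good : ∀ {v} → v ∈ U → (∀ z → ¬ E v z) → Found
  isolated-good {v} v∈ none = v , v∈ , (λ u _ vu → contradiction vu (none u)) , [] , inj₁ z≤n ,
    λ { w (_ , inj₁ vw) → contradiction vw (none w) ; w (_ , inj₂ (z , vz , _)) → contradiction vz (none z) }

  -- Near a leaf lie only `a` and the at most three other neighbours of `a`.
  leaf-good : ∀ {a v} → E a v → (∀ z → E v z → z ≡ a) → Found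
  leaf-good {a} {v} av only with Cover-remove (nbrs a) v av
  ... | R , len , mem = v , proj₁ (proj₂ av) ,
    (λ u w vu vw u≢w → contradiction (trans (only u vu) (≡-sym (only w vw))) u≢w) ,
    a ∷ R , inj₁ (s≤s len) ,
    λ { w (_ , inj₁ vw) → here (only w vw)
      ; w (w≢v , inj₂ (z , vz , zw)) → there (mem w (subst (λ z → E z w) (only z vz) zw , w≢v)) }

  -- The tip `v` of `ax` is good: `x` has no neighbours besides `a`, `b`, `v`, and `a` has at most
  -- one besides `v`, `x`, `b`. That leaves at most four vertices near `v`.
  tip-bare-good : ∀ {a b x v} → E a b → Btw a x b → E a x → Tip a x v → Bare x b → Found
  tip-bare-good {a} {b} {x} {v} ab x-btw ax t bare-xb
    with Cover-remove (Cover-remove (Cover-remove (nbrs a) v (edgeˡ t)) x (ax , ≢-sym (E⇒≢ (edgeʳ t)))) b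
           ((ab , ≢-sym (Btw⇒≢ʳ (widenʳ x-btw (between t)))) , ≢-sym (Btw⇒≢ʳ x-btw))
  ... | R , len , mem = tip-good ax t (x ∷ b ∷ a ∷ R) (inj₁ (s≤s (s≤s (s≤s len)))) coverᵃ coverˣ
    where
    coverᵃ : ∀ w → w ≢ v → E a w → w ∈ₗ x ∷ b ∷ a ∷ R
    coverᵃ w w≢v aw with w ≟ x | w ≟ b
    ... | yes eq | _ = here eq
    ... | no _ | yes eq = there (here eq)
    ... | no w≢x | no w≢b = there (there (there (mem w (((aw , w≢v) , w≢x) , w≢b))))
    coverˣ : ∀ w → w ≢ v → E x w → w ∈ₗ x ∷ b ∷ a ∷ R
    coverˣ w w≢v xw with apex-nbrs ab x-btw xw
    ... | inj₁ eq = there (there (here eq))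
    ... | inj₂ (inj₁ eq) = there (here eq)
    ... | inj₂ (inj₂ (inj₁ y)) = contradiction (tip-unique t (proj₁ (proj₂ xw)) y) w≢v
    ... | inj₂ (inj₂ (inj₂ y)) = contradiction y (bare-xb w (proj₁ (proj₂ xw)))

  fan-apex-nbrs : ∀ {a b x v y w} → E a b → Fan a b x v y → E x w → w ≡ a ⊎ w ≡ b ⊎ w ≡ v ⊎ w ≡ y
  fan-apex-nbrs ab f xw with apex-nbrs ab (between f) xw
  ... | inj₁ eq = inj₁ eq
  ... | inj₂ (inj₁ eq) = inj₂ (inj₁ eq)
  ... | inj₂ (inj₂ (inj₁ z)) = inj₂ (inj₂ (inj₁ (tip-unique (tipˡ f) (proj₁ (proj₂ xw)) z)))
  ... | inj₂ (inj₂ (inj₂ z)) = inj₂ (inj₂ (inj₂ (tip-unique (tipʳ f) (proj₁ (proj₂ xw)) z)))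

  -- The outer triangle abc completes the fan to a copy of F₄, and uses up the degree of a.
  fan-in-triangle-good : ∀ {a b c x v y} → E a b → E a c → E c b → Btw a b c → Fan a b x v y → Found
  fan-in-triangle-good {a} {b} {c} {x} {v} {y} ab ac cb b-btw f
    with Cover-remove (Cover-remove (Cover-remove (Cover-remove (nbrs a) v (edgeˡ (tipˡ f)))
           x (edgeˡ f , ≢-sym v≢x)) b ((ab , ≢-sym v≢b) , ≢-sym x≢b)) c (((ac , ≢-sym v≢c) , ≢-sym x≢c) , ≢-sym b≢c)
    where
    v≢x = Btw⇒≢ʳ (between (tipˡ f))
    x≢b = Btw⇒≢ʳ (between f)
    b≢c = Btw⇒≢ʳ b-btw
    v≢b = Btw⇒≢ʳ (widenʳ (between f) (between (tipˡ f)))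
    x≢c = Btw⇒≢ʳ (widenʳ b-btw (between f))
    v≢c = Btw⇒≢ʳ (widenʳ b-btw (widenʳ (between f) (between (tipˡ f))))
  -- With `v`, `x`, `b`, `c` the four places for neighbours of `a` are full, and `x` adds only `y`.
  -- The fifth entry is paid for by the copy of F₄.
  ... | [] , _ , mem = tip-good (edgeˡ f) (tipˡ f) (a ∷ x ∷ b ∷ c ∷ y ∷ []) (inj₂ (F4 , ≤-refl)) coverᵃ coverˣ
    where
    a-v-b = widenʳ (between f) (between (tipˡ f))
    a-y-b = widenˡ (between f) (between (tipʳ f))
    F4 : SubgraphOf adjF4 G
    -- The middle triangle is `a`, `x`, `b`; the outer vertices `v`, `y`, `c` sit on `ax`, `xb`,
    -- `ab`.
    F4 = F4-subgraph G (a ∷ x ∷ b ∷ v ∷ y ∷ c ∷ [])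
      ( (E⇒≢ (edgeˡ f) ∷ E⇒≢ ab ∷ E⇒≢ (edgeˡ (tipˡ f)) ∷ Btw⇒≢ˡ a-y-b ∷ E⇒≢ ac ∷ [])
      ∷ (E⇒≢ (edgeʳ f) ∷ ≢-sym (E⇒≢ (edgeʳ (tipˡ f))) ∷ E⇒≢ (edgeˡ (tipʳ f)) ∷ Btw⇒≢ʳ (widenʳ b-btw (between f)) ∷ [])
      ∷ (≢-sym (Btw⇒≢ʳ a-v-b) ∷ ≢-sym (E⇒≢ (edgeʳ (tipʳ f))) ∷ ≢-sym (E⇒≢ cb) ∷ [])
      ∷ ((λ { refl → disjoint (between f) (between (tipˡ f)) (between (tipʳ f)) }) ∷ Btw⇒≢ʳ (widenʳ b-btw a-v-b) ∷ [])
      ∷ (Btw⇒≢ʳ (widenʳ b-btw a-y-b) ∷ []) ∷ [] ∷ [])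
      ( e (edgeˡ f) ∷ e (edgeʳ f) ∷ e ab ∷ e (edgeˡ (tipˡ f)) ∷ e (E-sym (edgeʳ (tipˡ f)))
      ∷ e (edgeˡ (tipʳ f)) ∷ e (E-sym (edgeʳ (tipʳ f))) ∷ e ac ∷ e (E-sym cb) ∷ [])
      where
      e : ∀ {u w} → E u w → Edge (adj G) u w
      e (_ , _ , uw) = uw
    coverᵃ : ∀ w → w ≢ v → E a w → w ∈ₗ a ∷ x ∷ b ∷ c ∷ y ∷ []
    coverᵃ w w≢v aw with w ≟ x | w ≟ b | w ≟ c
    ... | yes eq | _ | _ = there (here eq)
    ... | no _ | yes eq | _ = there (there (here eq))
    ... | no _ | no _ | yes eq = there (there (there (here eq)))
    ... | no w≢x | no w≢b | no w≢c with mem w ((((aw , w≢v) , w≢x) , w≢b) , w≢c)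
    ...   | ()
    coverˣ : ∀ w → w ≢ v → E x w → w ∈ₗ a ∷ x ∷ b ∷ c ∷ y ∷ []
    coverˣ w w≢v xw with fan-apex-nbrs ab f xw
    ... | inj₁ eq = here eq
    ... | inj₂ (inj₁ eq) = there (there (here eq))
    ... | inj₂ (inj₂ (inj₁ eq)) = contradiction eq w≢v
    ... | inj₂ (inj₂ (inj₂ eq)) = there (there (there (there (here eq))))

  -- Two bare sides make a tip and two tips make a fan. A fan on one side forms F₄ with the outer
  -- triangle, and a tip opposite a bare side is good.
  triangle : ∀ {a b x} → E a b → E a x → E x b → Btw a x b → Shape a x → Shape x b → Found ⊎ Shape a b
  triangle ab ax xb x (fan _ _ _ f) _ = inj₁ (fan-in-triangle-good ax ab (E-sym xb) x f)
  triangle ab ax xb x _ (fan _ _ _ f) = inj₁ (fan-in-triangle-good (E-sym xb) (E-sym ab) ax (Btw-sym x) (Fan-sym f))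
  triangle ab ax xb x (bare p) (bare q) =
    inj₂ (tip _ record { between = x ; edgeˡ = ax ; edgeʳ = xb ; bareˡ = p ; bareʳ = q })
  triangle ab ax xb x (tip _ t) (bare q) = inj₁ (tip-bare-good ab x ax t q)
  triangle ab ax xb x (bare p) (tip _ t) = inj₁ (tip-bare-good (E-sym ab) (Btw-sym x) (E-sym xb) (Tip-sym t) (Bare-sym p))
  triangle ab ax xb x (tip _ s) (tip _ t) =
    inj₂ (fan _ _ _ record { between = x ; edgeˡ = ax ; edgeʳ = xb ; tipˡ = s ; tipʳ = t })

  -- Maximality of the jumps makes the path induced.
  data GreedyPath (b : Fin n) : Fin n → ℕ → Set where
    stop : GreedyPath b b 0
    step : ∀ {c c′ k} → E c c′ → Upto c b c′ → (∀ z → Upto c′ b z → ¬ E c z) →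
      GreedyPath b c′ k → GreedyPath b c (suc k)

  -- Greedy paths as induced paths

  module _ {b : Fin n} where

    vertices : ∀ {c k} → GreedyPath b c k → Fin (suc k) → Fin n
    vertices {c} _ zero = c
    vertices (step _ _ _ p) (suc i) = vertices p i

    vertices-after : ∀ {c k} (p : GreedyPath b c k) i → Upto c b (vertices p (suc i))
    vertices-after (step _ x _ p) zero    = x
    vertices-after (step _ x _ p) (suc i) = Upto-trans x (vertices-after p i)

    vertices-injective : ∀ {c k} (p : GreedyPath b c k) → Injective _≡_ _≡_ (vertices p)
    vertices-injective p {zero} {zero} _ = refl
    vertices-injective p {zero} {suc j} eq = contradiction eq (Upto⇒≢ (vertices-after p j))
    vertices-injective p {suc i} {zero} eq = contradiction (≡-sym eq) (Upto⇒≢ (vertices-after p i))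
    vertices-injective (step _ _ _ p) {suc i} {suc j} eq = cong suc (vertices-injective p eq)

    vertices-edge : ∀ {c k} (p : GreedyPath b c k) i j → toℕ j ≡ suc (toℕ i) → E (vertices p i) (vertices p j)
    vertices-edge (step e _ _ p) zero (suc zero) eq = e
    vertices-edge (step _ _ _ p) (suc i) (suc j) eq = vertices-edge p i j (suc-injective eq)

    -- A later vertex that is not the next one lies past the jump from the earlier vertex, and that
    -- jump was maximal.
    vertices-nonedge : ∀ {c k} (p : GreedyPath b c k) i j → toℕ i < toℕ j → toℕ j ≢ suc (toℕ i) →
      ¬ E (vertices p i) (vertices p j)
    vertices-nonedge p zero (suc zero) _ ne = contradiction refl ne
    vertices-nonedge (step _ _ max p) zero (suc (suc j)) _ _ = max _ (vertices-after p j)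
    vertices-nonedge (step _ _ _ p) (suc i) (suc j) i<j ne =
      vertices-nonedge p i j (≤-pred i<j) (ne ∘ cong suc)

    vertices≡end : ∀ {c k} (p : GreedyPath b c k) i → vertices p i ≡ b → toℕ i ≡ k
    vertices≡end stop zero _ = refl
    vertices≡end (step _ x _ _) zero eq = contradiction eq (Upto⇒≢end x)
    vertices≡end (step _ _ _ p) (suc i) eq = cong suc (vertices≡end p i eq)

    vertices-end : ∀ {c k} (p : GreedyPath b c k) i → toℕ i ≡ k → vertices p i ≡ b
    vertices-end stop zero _ = refl
    vertices-end (step _ _ _ p) (suc i) eq = vertices-end p i (suc-injective eq)

    vertices-alive : ∀ {c k} → b ∈ U → (p : GreedyPath b c k) → ∀ i → vertices p i ∈ U
    vertices-alive b∈ stop zero = b∈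
    vertices-alive b∈ (step e _ _ _) zero = proj₁ e
    vertices-alive b∈ (step _ _ _ p) (suc i) = vertices-alive b∈ p i

  -- Otherwise a, c, …, b is a chordless cycle of length at least 4.
  ¬greedyPath : ∀ {a b c k} → E a b → E a c → Btw a c b → (∀ z → Btw c z b → ¬ E a z) → ¬ E c b →
    ¬ GreedyPath b c k
  ¬greedyPath ab ac c-btw far ¬cb stop = Btw⇒≢ʳ c-btw refl
  ¬greedyPath ab ac c-btw far ¬cb (step e _ _ stop) = ¬cb e
  ¬greedyPath {a} {b} {c} ab ac c-btw far ¬cb p@(step {k = suc k} _ _ _ _) =
    -- The path has at least two edges here, so adding `a` gives a cycle on at least four vertices.
    let (i , j , i≢j , ¬adj , e) = chordal _ f (s≤s (s≤s (s≤s (s≤s z≤n)))) (f-injective , cycleEdges)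
    in chordless i j i≢j ¬adj (f-alive i , f-alive j , e)
    where
    f : Fin (suc (suc (suc (suc k)))) → Fin n
    f zero    = a
    f (suc i) = vertices p i

    fromA : ∀ i → Upto a b (vertices p i)
    fromA zero    = inj₁ c-btw
    fromA (suc i) = Upto-trans (inj₁ c-btw) (vertices-after p i)

    f-injective : Injective _≡_ _≡_ f
    f-injective {zero}  {zero}  _  = refl
    f-injective {zero}  {suc j} eq = contradiction eq (Upto⇒≢ (fromA j))
    f-injective {suc i} {zero}  eq = contradiction (≡-sym eq) (Upto⇒≢ (fromA i))
    f-injective {suc i} {suc j} eq = cong suc (vertices-injective p eq)

    f-alive : ∀ i → f i ∈ U
    f-alive zero    = proj₁ ab
    f-alive (suc i) = vertices-alive (proj₁ (proj₂ ab)) p i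

    consecEdge : ∀ i j → Consec i j → E (f i) (f j)
    consecEdge zero (suc zero) (inj₁ _) = ac
    -- The closing edge: the last vertex of the path is `b`.
    consecEdge zero (suc j) (inj₂ (_ , eq)) =
      subst (E a) (≡-sym (vertices-end p j (suc-injective (suc-injective eq)))) ab
    consecEdge (suc i) (suc j) (inj₁ eq) = vertices-edge p i j (suc-injective eq)

    cycleEdges : ∀ i j → CycAdj i j → Edge (adj G) (f i) (f j)
    cycleEdges i j (inj₁ x) = proj₂ (proj₂ (consecEdge i j x))
    cycleEdges i j (inj₂ x) = proj₂ (proj₂ (E-sym (consecEdge j i x)))

    chordless< : ∀ i j → toℕ i < toℕ j → ¬ Consec i j → ¬ E (f i) (f j)
    chordless< zero (suc zero) _ ¬adj = contradiction (inj₁ refl) ¬adj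
    -- By `far`, `a` has no neighbour strictly between `c` and `b`; the edge to `b` itself is the
    -- closing edge, not a chord.
    chordless< zero (suc (suc j)) _ ¬adj with vertices-after p j
    ... | inj₁ x = far _ x
    ... | inj₂ (eq , _) = contradiction (inj₂ (refl , cong (2 +_) (vertices≡end p (suc j) eq))) ¬adj
    chordless< (suc i) (suc j) i<j ¬adj = vertices-nonedge p i j (≤-pred i<j) (¬adj ∘ inj₁ ∘ cong suc)

    chordless : ∀ i j → i ≢ j → ¬ CycAdj i j → ¬ E (f i) (f j)
    chordless i j i≢j ¬adj e with <-cmp (toℕ i) (toℕ j)
    ... | tri< i<j _ _ = chordless< i j i<j (¬adj ∘ inj₁) e
    ... | tri≈ _ eq _ = i≢j (toℕ-injective eq)
    ... | tri> _ _ j<i = chordless< j i j<i (¬adj ∘ inj₂) (E-sym e)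

  -- Only a itself joins the interval from a (excluded) to r (included) to the rest of the graph.
  Hanging : Fin n → Fin n → Set
  Hanging a r = ∀ w z → E w z → Upto a r w → z ≡ a ⊎ Upto a r z

  -- Weaker than `Hanging`: `c` itself may still have neighbours beyond `c`.
  Sealed : Fin n → Fin n → Set
  Sealed a c = ∀ w z → E w z → Btw a w c → z ≡ a ⊎ Upto a c z

  -- Splitting the interval below an edge

  module _ {a b : Fin n} (ab : E a b) where

    -- Jump repeatedly to the farthest neighbour in the direction of `b`. If the walk gets stuck at
    -- some vertex, no edge leads past it, so everything up to it hangs from `a`; otherwise it
    -- reaches `b`.
    greedy : ∀ m c → dist c b < m → Btw a c b → c ∈ U → Sealed a c →
      (Σ[ s ∈ Fin n ] s ∈ U × Btw a s b × Hanging a s) ⊎ ∃ (GreedyPath b c)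
    greedy (suc m) c c<m c-btw c∈ sealed with argmax (λ z → E? c z ×-dec Upto? c b z) (dist c)
    ... | inj₁ none = inj₁ (c , c∈ , c-btw , hanging)
      where
      hanging : Hanging a c
      hanging w z wz (inj₁ x) = sealed w z wz x
      hanging w z wz (inj₂ (refl , _)) with apex-nbrs ab c-btw wz
      ... | inj₁ eq = inj₁ eq
      ... | inj₂ (inj₁ refl) = contradiction (wz , inj₂ (refl , Btw⇒≢ʳ c-btw)) (none z)
      ... | inj₂ (inj₂ (inj₁ x)) = inj₂ (inj₁ x)
      ... | inj₂ (inj₂ (inj₂ x)) = contradiction (wz , inj₁ x) (none z)
    ... | inj₂ (c′ , (cc′ , c′-upto) , max) = continue c′-upto
      where
      beyond : ∀ z → Upto c′ b z → ¬ E c z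
      beyond z x cz = farthest⇒¬beyond max c′-upto z x (cz , Upto-trans c′-upto x)

      continue : Upto c b c′ → _
      continue (inj₂ (refl , _)) = inj₂ (1 , step cc′ c′-upto beyond stop)
      continue (inj₁ c′-btw) with greedy m c′
          (<-≤-trans (subst₂ _<_ (dist-sym b c′) (dist-sym b c) (Btw⇒dist< (Btw-sym c′-btw))) (≤-pred c<m))
          (widenˡ c-btw c′-btw) (proj₁ (proj₂ cc′)) sealed′
        where
        a-c-c′ = narrow c-btw c′-btw
        sealed′ : Sealed a c′
        -- Either `w` is `c`, whose jump to `c′` was maximal, or `w` precedes `c` and the old seal
        -- applies, or `w` lies below the edge from `c` to `c′`, which confines it.
        sealed′ w z wz x with split a-c-c′ x
        sealed′ w z wz x | inj₁ refl with apex-nbrs ab c-btw wz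
        ... | inj₁ eq = inj₁ eq
        ... | inj₂ (inj₁ refl) = contradiction wz (beyond z (inj₂ (refl , Btw⇒≢ʳ c′-btw)))
        ... | inj₂ (inj₂ (inj₁ y)) = inj₂ (inj₁ (widenʳ a-c-c′ y))
        ... | inj₂ (inj₂ (inj₂ y)) with split c′-btw y
        ...   | inj₁ refl = inj₂ (inj₂ (refl , Btw⇒≢ a-c-c′))
        ...   | inj₂ (inj₁ z-btw) = inj₂ (inj₁ (widenˡ a-c-c′ z-btw))
        ...   | inj₂ (inj₂ z-btw) = contradiction wz (beyond z (inj₁ z-btw))
        sealed′ w z wz x | inj₂ (inj₁ y) with sealed w z wz y
        ... | inj₁ eq = inj₁ eq
        ... | inj₂ (inj₁ z-btw) = inj₂ (inj₁ (widenʳ a-c-c′ z-btw))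
        ... | inj₂ (inj₂ (refl , _)) = inj₂ (inj₁ a-c-c′)
        sealed′ w z wz x | inj₂ (inj₂ y) with confined cc′ y wz
        ... | inj₁ refl = inj₂ (inj₁ a-c-c′)
        ... | inj₂ (inj₁ refl) = inj₂ (inj₂ (refl , Btw⇒≢ a-c-c′))
        ... | inj₂ (inj₂ z-btw) = inj₂ (inj₁ (widenˡ a-c-c′ z-btw))
      ... | inj₁ hangs = inj₁ hangs
      ... | inj₂ (k , p) = inj₂ (suc k , step cc′ c′-upto beyond p)

  -- The tip `y` next to `r` is good: its neighbours are `x` and `r`, and since the piece hangs from
  -- `a`, these lead only to `a`, `v` and each other.
  fan-end-good : ∀ {a r x v y} → E a r → Hanging a r → Fan a r x v y → Found
  fan-end-good {a} {r} {x} {v} {y} ar hangs f =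
    tip-good (edgeʳ f) (tipʳ f) (x ∷ a ∷ r ∷ v ∷ []) (inj₁ ≤-refl) coverˣ coverʳ
    where
    coverˣ : ∀ w → w ≢ y → E x w → w ∈ₗ x ∷ a ∷ r ∷ v ∷ []
    coverˣ w w≢y xw with fan-apex-nbrs ar f xw
    ... | inj₁ eq = there (here eq)
    ... | inj₂ (inj₁ eq) = there (there (here eq))
    ... | inj₂ (inj₂ (inj₁ eq)) = there (there (there (here eq)))
    ... | inj₂ (inj₂ (inj₂ eq)) = contradiction eq w≢y
    coverʳ : ∀ w → w ≢ y → E r w → w ∈ₗ x ∷ a ∷ r ∷ v ∷ []
    coverʳ w w≢y rw with hangs r w rw (inj₂ (refl , E⇒≢ ar))
    ... | inj₁ eq = there (here eq)
    ... | inj₂ (inj₂ (eq , _)) = there (there (here eq))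
    ... | inj₂ (inj₁ w-btw) with split (between f) w-btw
    ...   | inj₁ eq = here eq
    ...   | inj₂ (inj₁ z) = there (there (there (here (tip-unique (tipˡ f) (proj₁ (proj₂ rw)) z))))
    ...   | inj₂ (inj₂ z) = contradiction (tip-unique (tipʳ f) (proj₁ (proj₂ rw)) z) w≢y

  -- Apart from the tip, `r` has only the neighbour `a`, so near the tip lie `a` and at most three
  -- further neighbours of `a`.
  tip-end-good : ∀ {a r v} → E a r → Hanging a r → Tip a r v → Found
  tip-end-good {a} {r} {v} ar hangs t with Cover-remove (nbrs a) v (edgeˡ t)
  ... | R , len , mem = tip-good ar t (a ∷ R) (inj₁ (s≤s len)) (λ w w≢v aw → there (mem w (aw , w≢v))) coverʳ
    where
    coverʳ : ∀ w → w ≢ v → E r w → w ∈ₗ a ∷ R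
    coverʳ w w≢v rw with hangs r w rw (inj₂ (refl , E⇒≢ ar))
    ... | inj₁ eq = here eq
    ... | inj₂ (inj₁ x) = contradiction (tip-unique t (proj₁ (proj₂ rw)) x) w≢v
    ... | inj₂ (inj₂ (refl , _)) = contradiction rw E-irrefl

  end-good : ∀ {a r} → E a r → Hanging a r → Shape a r → Found
  end-good ar hangs (fan _ _ _ f) = fan-end-good ar hangs f
  end-good ar hangs (tip _ t) = tip-end-good ar hangs t
  end-good {a} {r} ar hangs (bare none) = leaf-good ar only
    where
    only : ∀ z → E r z → z ≡ a
    only z rz with hangs r z rz (inj₂ (refl , E⇒≢ ar))
    ... | inj₁ eq = eq
    ... | inj₂ (inj₁ x) = contradiction x (none z (proj₁ (proj₂ rz)))
    ... | inj₂ (inj₂ (refl , _)) = contradiction rz E-irrefl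

  -- Induction on the length of intervals

  shape : ∀ m a b → dist a b < m → E a b → Found ⊎ Shape a b
  -- Moves the root `a` towards `r`: to its farthest neighbour in the piece or, if it has none
  -- there, to the vertex nearest to it. The process ends with the edge `ar` or with `r` isolated.
  -- Calls to `shape` keep the bound `m`, but `shape` lowers it in every call it makes.
  hanging-good : ∀ m a r → dist a r < m → r ∈ U → a ≢ r → Hanging a r → Found

  shape (suc m) a b d<m ab with any? (λ x → E? a x ×-dec E? x b ×-dec Btw? a x b)
  shape (suc m) a b d<m ab | yes (x , ax , xb , x-btw)
    with shape m a x (<-≤-trans (Btw⇒dist< x-btw) (≤-pred d<m)) ax
       | shape m x b (<-≤-trans (subst₂ _<_ (dist-sym b x) (dist-sym b a) (Btw⇒dist< (Btw-sym x-btw))) (≤-pred d<m)) xb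
  ... | inj₁ found | _ = inj₁ found
  ... | inj₂ _ | inj₁ found = inj₁ found
  ... | inj₂ s | inj₂ t = triangle ab ax xb x-btw s t
  shape (suc m) a b d<m ab | no ¬common
    with argmax (λ z → (z ∈? U) ×-dec Btw? a z b) (dist b) | argmax (λ z → E? a z ×-dec Btw? a z b) (dist a)
  ... | inj₁ none | _ = inj₂ (bare λ w w∈ x → none w (w∈ , x))
  -- Here `s` is the vertex below `ab` nearest to `a`. As `a` has no neighbour there, everything
  -- from `s` on hangs from `b`.
  ... | inj₂ (s , (s∈ , s-btw) , max) | inj₁ none =
    inj₁ (hanging-good m b s
      (<-≤-trans (subst (dist b s <_) (dist-sym b a) (Btw⇒dist< (Btw-sym s-btw))) (≤-pred d<m))
      s∈ (≢-sym (Btw⇒≢ʳ s-btw)) hanging)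
    where
    inside⇒Upto : ∀ z → z ∈ U → Btw a z b → Upto b s z
    inside⇒Upto z z∈ x with split s-btw x
    ... | inj₁ eq = inj₂ (eq , ≢-sym (Btw⇒≢ʳ s-btw))
    ... | inj₂ (inj₂ y) = inj₁ (Btw-sym y)
    ... | inj₂ (inj₁ y) = contradiction (max z (z∈ , x)) (<⇒≱ (Btw⇒dist< (narrow (Btw-sym s-btw) (Btw-sym y))))
    Upto⇒inside : ∀ w → Upto b s w → Btw a w b
    Upto⇒inside w (inj₁ x) = widenˡ s-btw (Btw-sym x)
    Upto⇒inside w (inj₂ (refl , _)) = s-btw
    hanging : Hanging b s
    hanging w z wz w-upto with confined ab (Upto⇒inside w w-upto) wz
    ... | inj₁ refl = contradiction (E-sym wz , Upto⇒inside w w-upto) (none w)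
    ... | inj₂ (inj₁ eq) = inj₁ eq
    ... | inj₂ (inj₂ x) = inj₂ (inside⇒Upto z (proj₁ (proj₂ wz)) x)
  -- The walk starts at the farthest neighbour `c` of `a`. It cannot reach `b`: `c` is not adjacent
  -- to `b`, so the path would close to a chordless cycle. Hence a piece hangs from `a`.
  ... | inj₂ _ | inj₂ (c , (ac , c-btw) , max)
    with greedy ab (suc (dist c b)) c (n<1+n _) c-btw (proj₁ (proj₂ ac)) sealed
    where
    sealed : Sealed a c
    sealed w z wz x with confined ac x wz
    ... | inj₁ eq = inj₁ eq
    ... | inj₂ (inj₁ refl) = inj₂ (inj₂ (refl , Btw⇒≢ˡ c-btw))
    ... | inj₂ (inj₂ y) = inj₂ (inj₁ y)
  ...   | inj₁ (s , s∈ , s-btw , hanging) =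
          inj₁ (hanging-good m a s (<-≤-trans (Btw⇒dist< s-btw) (≤-pred d<m)) s∈ (Btw⇒≢ˡ s-btw) hanging)
  ...   | inj₂ (k , p) = contradiction p (¬greedyPath ab ac c-btw
          (λ z x az → <⇒≱ (Btw⇒dist< (narrow c-btw x)) (max z (az , widenˡ c-btw x)))
          (λ cb → ¬common (c , ac , cb , c-btw)))

  hanging-good (suc m) a r d<m r∈ a≢r hangs with argmax (λ z → E? a z ×-dec Upto? a r z) (dist a)
  ... | inj₂ (b , (ab , inj₂ (refl , _)) , _) with shape (suc m) a r d<m ab
  ...   | inj₁ found = found
  ...   | inj₂ s = end-good ab hangs s
  -- The edge `ab` shields what lies past `b` from what lies before it, so `b` can be the new root.
  hanging-good (suc m) a r d<m r∈ a≢r hangs | inj₂ (b , (ab , inj₁ b-btw) , max) =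
    hanging-good m b r (<-≤-trans (subst₂ _<_ (dist-sym r b) (dist-sym r a) (Btw⇒dist< (Btw-sym b-btw))) (≤-pred d<m))
      r∈ (Btw⇒≢ʳ b-btw) hanging
    where
    hanging : Hanging b r
    hanging w z wz w-upto with hangs w z wz (Upto-trans (inj₁ b-btw) w-upto)
    ... | inj₁ refl = contradiction (E-sym wz , Upto-trans (inj₁ b-btw) w-upto) (farthest⇒¬beyond max (inj₁ b-btw) w w-upto)
    ... | inj₂ (inj₂ (refl , _)) = inj₂ (inj₂ (refl , Btw⇒≢ʳ b-btw))
    ... | inj₂ (inj₁ x) with split b-btw x
    ...   | inj₁ eq = inj₁ eq
    ...   | inj₂ (inj₂ y) = inj₂ (inj₁ y)
    ...   | inj₂ (inj₁ y) with confined ab y (E-sym wz)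
    ...     | inj₁ refl = contradiction refl (Upto⇒≢ (Upto-trans (inj₁ b-btw) w-upto))
    ...     | inj₂ (inj₁ refl) = contradiction refl (Upto⇒≢ w-upto)
    ...     | inj₂ (inj₂ w-btw) = contradiction w-upto λ
                { (inj₁ v) → disjoint b-btw w-btw v ; (inj₂ (refl , _)) → Btw-asym b-btw w-btw }
  hanging-good (suc m) a r d<m r∈ a≢r hangs | inj₁ none with argmax (λ z → (z ∈? U) ×-dec Btw? a z r) (dist r)
  ... | inj₁ none′ = isolated-good r∈ isolated
    where
    isolated : ∀ z → ¬ E r z
    isolated z rz with hangs r z rz (inj₂ (refl , a≢r))
    ... | inj₁ refl = none r (E-sym rz , inj₂ (refl , a≢r))
    ... | inj₂ (inj₁ x) = none′ z (proj₁ (proj₂ rz) , x)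
    ... | inj₂ (inj₂ (refl , _)) = E-irrefl rz
  -- Farthest from `r` means nearest to `a`: no vertex of `U` lies between `a` and `a′`.
  ... | inj₂ (a′ , (a′∈ , a′-btw) , max) =
    hanging-good m a′ r (<-≤-trans (subst₂ _<_ (dist-sym r a′) (dist-sym r a) (Btw⇒dist< (Btw-sym a′-btw))) (≤-pred d<m))
      r∈ (Btw⇒≢ʳ a′-btw) hanging
    where
    hanging : Hanging a′ r
    hanging w z wz w-upto with hangs w z wz (Upto-trans (inj₁ a′-btw) w-upto)
    ... | inj₁ refl = contradiction (E-sym wz , Upto-trans (inj₁ a′-btw) w-upto) (none w)
    ... | inj₂ (inj₂ (refl , _)) = inj₂ (inj₂ (refl , Btw⇒≢ʳ a′-btw))
    ... | inj₂ (inj₁ x) with split a′-btw x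
    ...   | inj₁ eq = inj₁ eq
    ...   | inj₂ (inj₁ y) = contradiction (max z (proj₁ (proj₂ wz) , x)) (<⇒≱ (Btw⇒dist< (narrow (Btw-sym a′-btw) (Btw-sym y))))
    ...   | inj₂ (inj₂ y) = inj₂ (inj₁ y)

  -- With `r` the last and `a` the first vertex of `U`, all of `U` lies from `a` to `r`, so the
  -- piece hangs from `a` trivially.
  ∃-good : Nonempty U → Found
  ∃-good (u , u∈) with argmax (_∈? U) pos
  ... | inj₁ none = contradiction u∈ (none u)
  ... | inj₂ (r , r∈ , r-max) with argmax (λ z → (z ∈? U) ×-dec ¬? (z ≟ r)) (dist r)
  ...   | inj₁ none = isolated-good r∈ λ z rz → none z (proj₁ (proj₂ rz) , ≢-sym (E⇒≢ rz))
  ...   | inj₂ (a , (a∈ , a≢r) , a-max) = hanging-good (suc (dist a r)) a r (n<1+n _) r∈ a≢r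
            λ w z wz _ → everything z (proj₁ (proj₂ wz))
    where
    below-r : ∀ z → z ∈ U → z ≢ r → pos z < pos r
    below-r z z∈ z≢r = ≤∧≢⇒< (r-max z z∈) (z≢r ∘ pos-injective)
    everything : ∀ z → z ∈ U → z ≡ a ⊎ Upto a r z
    everything z z∈ with z ≟ r | <-cmp (pos z) (pos a)
    ... | yes z≡r | _ = inj₂ (inj₂ (z≡r , a≢r))
    ... | no z≢r | tri< z<a _ _ = contradiction (a-max z (z∈ , z≢r)) (<⇒≱ (Btw⇒dist< (inj₂ (z<a , below-r a a∈ a≢r))))
    ... | no z≢r | tri≈ _ eq _ = inj₁ (pos-injective eq)
    ... | no z≢r | tri> _ _ a<z = inj₂ (inj₁ (inj₁ (a<z , below-r z z∈ z≢r)))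

-- The square of a graph

anyFin⁺ : ∀ {n} (f : Fin n → Bool) i → f i ≡ true → anyFin f ≡ true
anyFin⁺ f zero eq rewrite eq = refl
anyFin⁺ f (suc i) eq rewrite anyFin⁺ (f ∘ suc) i eq = ∨-zeroʳ (f zero)

anyFin⁻ : ∀ {n} (f : Fin n → Bool) → anyFin f ≡ true → ∃ λ i → f i ≡ true
anyFin⁻ {suc n} f eq with f zero in eq₀
... | true  = zero , eq₀
... | false = let (i , eqᵢ) = anyFin⁻ (f ∘ suc) eq in suc i , eqᵢ

module _ {n} (G : SimpleGraph n) where

  Within2 : Fin n → Fin n → Set
  Within2 u v = Edge (adj G) u v ⊎ ∃ λ w → Edge (adj G) u w × Edge (adj G) w v

  square⁺ : ∀ {u v} → u ≢ v → Within2 u v → Edge (G ²) u v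
  square⁺ {u} {v} u≢v near with u ≟ v | near
  ... | yes u≡v | _ = contradiction u≡v u≢v
  ... | no _ | inj₁ uv rewrite uv = refl
  ... | no _ | inj₂ (w , uw , wv)
    rewrite anyFin⁺ (λ w → adj G u w ∧ adj G w v) w (subst₂ (λ x y → x ∧ y ≡ true) (≡-sym uw) (≡-sym wv) refl) =
    ∨-zeroʳ (adj G u v)

  square⁻ : ∀ {u v} → Edge (G ²) u v → u ≢ v × Within2 u v
  square⁻ {u} {v} e with u ≟ v
  ... | no u≢v with adj G u v in uv
  ...   | true  = u≢v , inj₁ refl
  ...   | false with anyFin⁻ (λ w → adj G u w ∧ adj G w v) e
  ...     | w , eq with adj G u w in uw | adj G w v in wv
  ...       | true | true = u≢v , inj₂ (w , uw , wv)

  Within2-sym : ∀ {u v} → Within2 u v → Within2 v u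
  Within2-sym (inj₁ uv) = inj₁ (trans (sym G _ _) uv)
  Within2-sym (inj₂ (w , uw , wv)) = inj₂ (w , trans (sym G _ _) wv , trans (sym G _ _) uw)

  square-sym : ∀ u v → Edge (G ²) u v → Edge (G ²) v u
  square-sym u v e = let (u≢v , near) = square⁻ e in square⁺ (≢-sym u≢v) (Within2-sym near)

  square-irrefl : ∀ v → ¬ Edge (G ²) v v
  square-irrefl v e = proj₁ (square⁻ e) refl

  -- Any two neighbours of `v` are joined by a path through `v`.
  closedNbhd-clique : ∀ v → HasClique (G ²) (suc (degree G v))
  closedNbhd-clique v with enumerate (Vec.tabulate (adj G v))
  ... | g , g-injective , mem = f , f-injective , edges
    where
    star : ∀ i → Edge (adj G) v (g i)
    star i = ∈-tabulate⁻ (adj G v) (mem i)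
    star′ : ∀ i → Edge (adj G) (g i) v
    star′ i = trans (sym G _ _) (star i)
    v≢g : ∀ i → v ≢ g i
    v≢g i eq with trans (≡-sym (irrefl G v)) (trans (cong (adj G v) eq) (star i))
    ... | ()
    f : Fin (suc (degree G v)) → Fin n
    f zero    = v
    f (suc i) = g i
    f-injective : Injective _≡_ _≡_ f
    f-injective {zero}  {zero}  _  = refl
    f-injective {zero}  {suc j} eq = contradiction eq (v≢g j)
    f-injective {suc i} {zero}  eq = contradiction (≡-sym eq) (v≢g i)
    f-injective {suc i} {suc j} eq = cong suc (g-injective eq)
    near : ∀ i j → i ≢ j → Within2 (f i) (f j)
    near zero    zero    i≢j = contradiction refl i≢j
    near zero    (suc j) _   = inj₁ (star j)
    near (suc i) zero    _   = inj₁ (star′ i)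
    near (suc i) (suc j) _   = inj₂ (v , star′ i , star j)
    edges : ∀ i j → i ≢ j → Edge (G ²) (f i) (f j)
    edges i j i≢j = square⁺ (i≢j ∘ f-injective) (near i j i≢j)

-- Decided over all pairs; it turns a copy of F₄ into a 6-clique of G².
F4-diameter : ∀ i j → i ≢ j → Edge adjF4 i j ⊎ ∃ λ w → Edge adjF4 i w × Edge adjF4 w j
F4-diameter = from-yes (all? λ i → all? λ j → ¬? (i ≟ j) →-dec
  ((adjF4 i j ≟ᵇ true) ⊎-dec any? λ w → (adjF4 i w ≟ᵇ true) ×-dec (adjF4 w j ≟ᵇ true)))

F4-clique : ∀ {n} (G : SimpleGraph n) → SubgraphOf adjF4 G → HasClique (G ²) 6
F4-clique G (f , inj , preserves) = f , inj , edges
  where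
  edges : ∀ i j → i ≢ j → Edge (G ²) (f i) (f j)
  edges i j i≢j with F4-diameter i j i≢j
  ... | inj₁ e = square⁺ G (i≢j ∘ inj) (inj₁ (preserves i j e))
  ... | inj₂ (w , e , e′) = square⁺ G (i≢j ∘ inj) (inj₂ (f w , preserves i w e , preserves w j e′))

-- Degeneracy of the square

module _ {n} (G : SimpleGraph n) (k : ℕ)
  (small : ∀ m → Small G m → m ≤ k)
  (∃-good : ∀ U → Nonempty U → ∃ (Alive.Good G U)) where

  -- Deleting simplicial vertices keeps G²[U] equal to (G[U])², so the first
  -- deleted vertex of S has few neighbours among the others.
  eliminate : ∀ m U → ∣ U ∣ < m → (∀ u w → u ∈ U → w ∈ U → Edge (G ²) u w → Alive.Near G U u w) →
    ∀ S → S ⊆ U → Nonempty S → Σ[ v ∈ Fin n ] v ∈ S × Cover (λ w → w ∈ S × Edge (G ²) v w) k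
  eliminate (suc m) U size near S S⊆U (s , s∈) with ∃-good U (s , S⊆U s∈)
  ... | v , v∈U , simplicial , L , len , mem with v ∈? S
  ...   | yes v∈S = v , v∈S , L , small _ len , λ w (w∈S , e) → mem w (near v w v∈U (S⊆U w∈S) e)
  ...   | no v∉S = eliminate m (U ∖ v) (<-≤-trans (x∈p⇒∣p-x∣<∣p∣ v∈U) (≤-pred size)) near′ S S⊆U∖v (s , s∈)
    where
    S⊆U∖v : S ⊆ U ∖ v
    S⊆U∖v x∈S = x∈p∧x≢y⇒x∈p-y (S⊆U x∈S) λ { refl → v∉S x∈S }
    near′ : ∀ u w → u ∈ U ∖ v → w ∈ U ∖ v → Edge (G ²) u w → Alive.Near G (U ∖ v) u w
    near′ u w u∈ w∈ e with near u w (p─q⊆p U _ u∈) (p─q⊆p U _ w∈) e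
    ... | w≢u , inj₁ (_ , _ , uw) = w≢u , inj₁ (u∈ , w∈ , uw)
    ... | w≢u , inj₂ (z , uz@(_ , z∈ , eᵘ) , zw@(_ , _ , eʷ)) with z ≟ v
    -- The deleted vertex was the middle of the path; as it is simplicial, `u` and `w` are adjacent.
    ...   | yes refl = w≢u , inj₁ (u∈ , w∈ , proj₂ (proj₂ (simplicial u w (Alive.E-sym G U uz) zw (≢-sym w≢u))))
    ...   | no z≢v = let z∈′ = x∈p∧x≢y⇒x∈p-y z∈ z≢v in w≢u , inj₂ (z , (u∈ , z∈′ , eᵘ) , (z∈′ , w∈ , eʷ))

  square-degenerate : Degenerate (G ²) k
  square-degenerate S = eliminate (suc n) ⊤ (s≤s (∣p∣≤n ⊤)) near S (λ _ → ∈⊤)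
    where
    near : ∀ u w → u ∈ ⊤ → w ∈ ⊤ → Edge (G ²) u w → Alive.Near G ⊤ u w
    near u w _ _ e with square⁻ G e
    ... | u≢w , inj₁ uw = ≢-sym u≢w , inj₁ (∈⊤ , ∈⊤ , uw)
    ... | u≢w , inj₂ (z , uz , zw) = ≢-sym u≢w , inj₂ (z , (∈⊤ , ∈⊤ , uz) , (∈⊤ , ∈⊤ , zw))

theorem4p5 : ∀ {n} (G : SimpleGraph n) → Chordal G → Outerplanar G → MaxDegree G 4 →
    (SubgraphOf adjF4 G → CliqueNumber (G ²) 6 × ChromaticNumber (G ²) 6 × Inductiveness (G ²) 5) ×
    (¬ SubgraphOf adjF4 G → CliqueNumber (G ²) 5 × ChromaticNumber (G ²) 5 × Inductiveness (G ²) 4)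
theorem4p5 G chordal (σ , σ-injective , noncrossing) (degree≤4 , v , degree≡4) =
  (λ F4 → clique×degenerate (square-sym G) (square-irrefl G) (F4-clique G F4) (square-degenerate G 5 small₅ good)) ,
  (λ ¬F4 → clique×degenerate (square-sym G) (square-irrefl G) star (square-degenerate G 4 (small₄ ¬F4) good))
  where
  good : ∀ U → Nonempty U → ∃ (Alive.Good G U)
  good U = GoodVertex.∃-good G U chordal (toℕ ∘ σ) (σ-injective ∘ toℕ-injective) noncrossing degree≤4
  star : HasClique (G ²) 5
  -- The vertex of degree four together with its neighbours gives five vertices.
  star = subst (HasClique (G ²) ∘ suc) degree≡4 (closedNbhd-clique G v)
  small₅ : ∀ m → Small G m → m ≤ 5
  small₅ m (inj₁ m≤4) = ≤-trans m≤4 (n≤1+n 4)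
  small₅ m (inj₂ (_ , m≤5)) = m≤5
  small₄ : ¬ SubgraphOf adjF4 G → ∀ m → Small G m → m ≤ 4
  small₄ ¬F4 m (inj₁ m≤4) = m≤4
  small₄ ¬F4 m (inj₂ (F4 , _)) = contradiction F4 ¬F4
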